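{- Every obligation $\mathrm{LTL}_f{+}$ formula $\Psi$ can be translated into an equivalent deterministic weak automaton (DWA) of size $2^{2^{\mathcal{O}(|\Psi|)}}$. That is, there is a constant $c$ such that for every obligation formula $\Psi$ over $AP$ there is a DWA over the alphabet $2^{AP}$ with at most $2^{2^{c|\Psi|}}$ states which accepts exactly the infinite traces $\tau\in(2^{AP})^\omega$ that satisfy $\Psi$.
   Context: **$\mathrm{LTL}_f$.** Let $AP$ be a finite set of atomic propositions. $\mathrm{LTL}_f$ formulas are $\varphi,\psi ::= p \mid \neg\varphi \mid \varphi\wedge\psi \mid \mathsf{X}\varphi \mid \varphi\,\mathsf{U}\,\psi$ ($p\in AP$), evaluated at positions $0\le i<|\tau|$ of nonempty finite traces $\tau$ over $2^{AP}$: $\tau,i\models p$ iff $p\in\tau_i$; Boolean cases as usual; $\tau,i\models\mathsf{X}\varphi$ iff $i+1<|\tau|$ implies $\tau,i+1\models\varphi$ (weak next; strong next is $\neg\mathsf{X}\neg\varphi$); $\tau,i\models\varphi\,\mathsf{U}\,\psi$ iff there is $j$ with $i\le j<|\tau|$, $\tau,j\models\psi$ and $\tau,j'\models\varphi$ for all $i\le j'<j$. Put $[\Phi]=\{\tau\mid \tau,0\models\Phi\}$. **Obligation formulas of $\mathrm{LTL}_f{+}$.** $\Psi,\Psi' ::= \forall\Phi\mid\exists\Phi\mid\Psi\vee\Psi'\mid\Psi\wedge\Psi'\mid\neg\Psi$, where $\Phi$ is an $\mathrm{LTL}_f$ formula. They are evaluated on infinite traces $\tau\in(2^{AP})^\omega$: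 $\tau$ satisfies $\exists\Phi$ (resp. $\forall\Phi$) iff some (resp. every) nonempty finite prefix of $\tau$ is in $[\Phi]$; Boolean connectives are interpreted as usual. $|\Psi|$ is the number of symbols of $\Psi$. **Deterministic weak automata (DWA).** A DWA is a pair $(T,F)$ where $T=(\Sigma,Q,\iota,\delta)$ is a deterministic transition system (finite alphabet $\Sigma$, finite state set $Q$, initial state $\iota$, total transition function $\delta:Q\times\Sigma\to Q$) and $F\subseteq Q$ is such that every strongly connected component (SCC: maximal set of mutually reachable states) $S$ satisfies $S\subseteq F$ or $S\cap F=\emptyset$. It accepts an infinite word iff the unique run on it visits $F$ infinitely often. The size of a DWA is its number of states. -}

module Defs where

open import Data.Fin.Base as Fin using (Fin; zero; suc; toℕ; fromℕ<)
open import Data.Fin.Subset using (Subset; _∈_; _⊆_; _∩_; Empty)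
open import Data.Nat.Base as ℕ using (ℕ; zero; suc; _+_)
open import Data.Product.Base using (_×_; ∃; ∃-syntax)
open import Data.Sum.Base using (_⊎_)
open import Data.Vec.Base using (Vec; lookup; tabulate)
open import Relation.Binary.Construct.Closure.ReflexiveTransitive using (Star)
open import Relation.Binary.PropositionalEquality using (_≡_)
open import Relation.Nullary.Negation using (¬_)

-- AP is Fin k, so the alphabet 2^AP is Subset k.
Letter : ℕ → Set
Letter k = Subset k

InfTrace : Set → Set
InfTrace Σ = ℕ → Σ

prefix : {Σ : Set} (n : ℕ) → InfTrace Σ → Vec Σ n
prefix n τ = tabulate (λ i → τ (toℕ i))

infixr 25 ~_ X_ ∀ᵖ_ ∃ᵖ_
infixr 22 _U_
infixr 20 _∧_
infixr 15 _∨_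

data LTLf (k : ℕ) : Set where
  atom : Fin k → LTLf k
  ~_   : LTLf k → LTLf k
  _∧_  : LTLf k → LTLf k → LTLf k
  X_   : LTLf k → LTLf k
  _U_  : LTLf k → LTLf k → LTLf k

-- Positions 0 ≤ i < |τ| are the elements of Fin n, and X is the weak next.
infix 4 _at_⊨_
_at_⊨_ : {k n : ℕ} → Vec (Letter k) n → Fin n → LTLf k → Set
τ at i ⊨ atom p  = p ∈ lookup τ i
τ at i ⊨ (~ φ)   = ¬ (τ at i ⊨ φ)
τ at i ⊨ (φ ∧ ψ) = (τ at i ⊨ φ) × (τ at i ⊨ ψ)
_at_⊨_ {n = n} τ i (X φ) = (i+1<n : suc (toℕ i) ℕ.< n) → τ at fromℕ< i+1<n ⊨ φ
τ at i ⊨ (φ U ψ) =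
  ∃[ j ] i Fin.≤ j × (τ at j ⊨ ψ) × (∀ j′ → i Fin.≤ j′ → j′ Fin.< j → τ at j′ ⊨ φ)

-- The language [Φ], a predicate on nonempty finite traces.
[_] : {k : ℕ} → LTLf k → {m : ℕ} → Vec (Letter k) (suc m) → Set
[ Φ ] τ = τ at zero ⊨ Φ

data Obligation (k : ℕ) : Set where
  ∀ᵖ_ : LTLf k → Obligation k
  ∃ᵖ_ : LTLf k → Obligation k
  _∨_ : Obligation k → Obligation k → Obligation k
  _∧_ : Obligation k → Obligation k → Obligation k
  ~_  : Obligation k → Obligation k

infix 4 _⊨_
_⊨_ : {k : ℕ} → InfTrace (Letter k) → Obligation k → Set
τ ⊨ (∀ᵖ Φ)   = ∀ m → [ Φ ] (prefix (suc m) τ)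
τ ⊨ (∃ᵖ Φ)   = ∃[ m ] [ Φ ] (prefix (suc m) τ)
τ ⊨ (Ψ ∨ Ψ′) = (τ ⊨ Ψ) ⊎ (τ ⊨ Ψ′)
τ ⊨ (Ψ ∧ Ψ′) = (τ ⊨ Ψ) × (τ ⊨ Ψ′)
τ ⊨ (~ Ψ)    = ¬ (τ ⊨ Ψ)

∣_∣ᶠ : {k : ℕ} → LTLf k → ℕ
∣ atom p ∣ᶠ = 1
∣ ~ φ ∣ᶠ    = 1 + ∣ φ ∣ᶠ
∣ φ ∧ ψ ∣ᶠ  = 1 + (∣ φ ∣ᶠ + ∣ ψ ∣ᶠ)
∣ X φ ∣ᶠ    = 1 + ∣ φ ∣ᶠ
∣ φ U ψ ∣ᶠ  = 1 + (∣ φ ∣ᶠ + ∣ ψ ∣ᶠ)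

∣_∣ : {k : ℕ} → Obligation k → ℕ
∣ ∀ᵖ Φ ∣   = 1 + ∣ Φ ∣ᶠ
∣ ∃ᵖ Φ ∣   = 1 + ∣ Φ ∣ᶠ
∣ Ψ ∨ Ψ′ ∣ = 1 + (∣ Ψ ∣ + ∣ Ψ′ ∣)
∣ Ψ ∧ Ψ′ ∣ = 1 + (∣ Ψ ∣ + ∣ Ψ′ ∣)
∣ ~ Ψ ∣    = 1 + ∣ Ψ ∣

-- The alphabet is a parameter; finiteness is not recorded because only the
-- instances Σ = Letter k are used.
record TransitionSystem (Σ : Set) : Set where
  field
    size : ℕ
  Q : Set
  Q = Fin size
  field
    ι : Q
    δ : Q → Σ → Q

  Reachable : Q → Q → Set
  Reachable = Star (λ p q → ∃[ a ] δ p a ≡ q)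

  MutuallyReachable : Subset size → Set
  MutuallyReachable S = ∀ {p q} → p ∈ S → q ∈ S → Reachable p q

  -- Reachable is reflexive, so a state on no cycle forms an SCC by itself.
  IsSCC : Subset size → Set
  IsSCC S = MutuallyReachable S × (∀ S′ → S ⊆ S′ → MutuallyReachable S′ → S′ ⊆ S)

  run : InfTrace Σ → ℕ → Q
  run w zero    = ι
  run w (suc i) = δ (run w i) (w i)

record DWA (Σ : Set) : Set where
  field
    T : TransitionSystem Σ
  open TransitionSystem T public
  field
    F    : Subset size
    weak : ∀ S → IsSCC S → S ⊆ F ⊎ Empty (S ∩ F)

  Accepts : InfTrace Σ → Set
  Accepts w = ∀ i → ∃[ j ] i ℕ.≤ j × run w j ∈ F

{-# OPTIONS --safe #-}

-- Truth of Φ at the first position of a finite trace is computed by reading the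
-- trace from right to left, with a memory of one bit per X- and U-subformula.
-- Reading from left to right instead, it suffices to maintain the set of
-- memories from which the letters read so far, traversed backwards, lead to Φ
-- being true: a DFA with doubly exponentially many states. Turning its final
-- states into a single absorbing one yields a weak automaton for ∃Φ. Boolean
-- combinations are products: no component changes its verdict within an SCC,
-- and each verdict eventually stabilises along a run.
module Submission where

open import Defs
open import Axiom.ExcludedMiddle using (ExcludedMiddle)
open import Data.Nat.Base using (ℕ; _*_; _^_; _≤_)
open import Data.Product.Base using (_×_; Σ-syntax; ∃-syntax)
open import Function.Bundles using (_⇔_)
open import Level using (0ℓ)

open import Data.Bool.Base as Bool using (Bool; true; false; not; if_then_else_)
open import Data.Fin.Base as Fin
  using (Fin; zero; suc; fromℕ<; combine; remQuot; finToFun; funToFin)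
open import Data.Fin.Properties
  using (1↔⊤; 2↔Bool; *↔×; remQuot-combine; finToFun-funToFin)
open import Data.Fin.Subset using (Subset; _∈_; _⊆_; _∩_; Empty)
open import Data.Fin.Subset.Properties using (_∈?_; nonempty?; x∈p∩q⁻)
open import Data.Nat.Base as ℕ using (zero; suc; _+_; _⊔_; z≤n; s≤s; s≤s⁻¹; z<s)
open import Data.Nat.Properties
open import Data.Product.Base using (∃; _,_; proj₁; proj₂)
open import Data.Product.Function.NonDependent.Propositional using (_×-↔_; _×-⇔_)
open import Data.Sum.Base using (_⊎_; inj₁; inj₂)
open import Data.Unit.Base using (⊤)
open import Data.Vec.Base using (Vec; []; _∷_; tabulate)
open import Data.Vec.Properties using (lookup∘tabulate; []=⇒lookup; lookup⇒[]=)
open import Function.Base using (_∘_)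
open import Function.Bundles using (_↔_; mk⇔; module Equivalence; module Inverse)
open import Function.Properties.Inverse using (↔-sym; ↔-trans)
open import Relation.Binary.Construct.Closure.ReflexiveTransitive
  using (ε; _◅_; gmap)
open import Relation.Binary.PropositionalEquality
  using (_≡_; refl; sym; trans; cong; cong₂; subst; module ≡-Reasoning)
open import Relation.Nullary.Decidable as Dec
  using (Dec; does; proof; yes; no; _because_; ¬?; _×-dec_; _⊎-dec_; decidable-stable)
open import Relation.Nullary.Negation using (¬_)
open import Relation.Nullary.Reflects as Reflects
  using (Reflects; ofʸ; ofⁿ; ¬-reflects; _×-reflects_; _⊎-reflects_)

private
  variable
    k n : ℕ
    Σ S : Set

reflects-⇔ : {A B : Set} {b : Bool} → A ⇔ B → Reflects A b → Reflects B b
reflects-⇔ A⇔B r = proof (Dec.map A⇔B (_ because r))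

¬-⇔ : {A B : Set} → A ⇔ B → (¬ A) ⇔ (¬ B)
¬-⇔ A⇔B = mk⇔ (_∘ from) (_∘ to)
  where open Equivalence A⇔B

-- Suffixes

-- Every operator looks only to the right, so no formula can see a letter to the left of its
-- position.
at-suc : ∀ (φ : LTLf k) a (τ : Vec (Letter k) n) i →
         (a ∷ τ at suc i ⊨ φ) ⇔ (τ at i ⊨ φ)
at-suc (atom p) a τ i = mk⇔ (λ x → x) (λ x → x)
at-suc (~ φ)    a τ i = ¬-⇔ (at-suc φ a τ i)
at-suc (φ ∧ ψ)  a τ i = at-suc φ a τ i ×-⇔ at-suc ψ a τ i
at-suc (X φ)    a τ i = mk⇔
  (λ f i<n → to (at-suc φ a τ _) (f (s≤s i<n)))
  (λ f i<n → from (at-suc φ a τ _) (f (s≤s⁻¹ i<n)))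
  where open Equivalence
at-suc (φ U ψ)  a τ i = mk⇔
  (λ { (suc j , i≤j , q , p) →
       j , s≤s⁻¹ i≤j , to (at-suc ψ a τ j) q ,
       λ j′ i≤j′ j′<j → to (at-suc φ a τ j′) (p (suc j′) (s≤s i≤j′) (s≤s j′<j)) })
  (λ { (j , i≤j , q , p) →
       suc j , s≤s i≤j , from (at-suc ψ a τ j) q ,
       λ { (suc j′) i≤j′ j′<j → from (at-suc φ a τ j′) (p j′ (s≤s⁻¹ i≤j′) (s≤s⁻¹ j′<j)) } })
  where open Equivalence

-- Next and Until also apply to the empty trace, which has no position to
-- evaluate a formula at; this serves as the base case of right-to-left evaluation.
Next : LTLf k → Vec (Letter k) n → Set
Next {n = n} φ τ = (0<n : 0 ℕ.< n) → τ at fromℕ< 0<n ⊨ φ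

Until : LTLf k → LTLf k → Vec (Letter k) n → Set
Until φ ψ τ = ∃[ j ] (τ at j ⊨ ψ) × (∀ j′ → j′ Fin.< j → τ at j′ ⊨ φ)

Next-unfold : ∀ (φ : LTLf k) a (τ : Vec (Letter k) n) →
              Next φ τ ⇔ (a ∷ τ at zero ⊨ X φ)
Next-unfold φ a τ = mk⇔
  (λ f 1<n → from (at-suc φ a τ _) (f (s≤s⁻¹ 1<n)))
  (λ f 0<n → to (at-suc φ a τ _) (f (s≤s 0<n)))
  where open Equivalence

Until⇔U : ∀ (φ ψ : LTLf k) a (τ : Vec (Letter k) n) →
          Until φ ψ (a ∷ τ) ⇔ (a ∷ τ at zero ⊨ φ U ψ)
Until⇔U φ ψ a τ = mk⇔
  (λ { (j , q , p) → j , z≤n , q , λ j′ _ → p j′ })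
  (λ { (j , _ , q , p) → j , q , λ j′ → p j′ z≤n })

-- The expansion law of Until. As `Until` fails on the empty trace, its occurrence for `τ` acts as a
-- strong next.
Until-unfold : ∀ (φ ψ : LTLf k) a (τ : Vec (Letter k) n) →
               ((a ∷ τ at zero ⊨ ψ) ⊎ ((a ∷ τ at zero ⊨ φ) × Until φ ψ τ)) ⇔ Until φ ψ (a ∷ τ)
Until-unfold φ ψ a τ = mk⇔
  (λ { (inj₁ q) → zero , q , λ _ ()
     ; (inj₂ (p₀ , j , q , p)) →
         suc j , from (at-suc ψ a τ j) q ,
         λ { zero _ → p₀
           ; (suc j′) j′<j → from (at-suc φ a τ j′) (p j′ (s≤s⁻¹ j′<j)) } })
  (λ { (zero , q , _) → inj₁ q
     ; (suc j , q , p) →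
         inj₂ (p zero z<s , j , to (at-suc ψ a τ j) q ,
               λ j′ j′<j → to (at-suc φ a τ j′) (p (suc j′) (s≤s j′<j))) })
  where open Equivalence

-- Right-to-left evaluation

-- The bit of X φ holds the value of X φ one position to the left, and the bit
-- of φ U ψ the value of φ U ψ at the current position (false past the end).
Memory : LTLf k → Set
Memory (atom p) = ⊤
Memory (~ φ)    = Memory φ
Memory (φ ∧ ψ)  = Memory φ × Memory ψ
Memory (X φ)    = Bool × Memory φ
Memory (φ U ψ)  = Bool × (Memory φ × Memory ψ)

end : (φ : LTLf k) → Memory φ
end (atom p) = _
end (~ φ)    = end φ
end (φ ∧ ψ)  = end φ , end ψ
-- At the last position a weak next holds vacuously.
end (X φ)    = true , end φ
end (φ U ψ)  = false , end φ , end ψ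

-- The memory is that of the suffix after `a`. Hence `b` is already the answer for `X φ`, but for
-- `φ U ψ` it is the value one position later, as the expansion law requires.
value : (φ : LTLf k) → Letter k → Memory φ → Bool
value (atom p) a _           = does (p ∈? a)
value (~ φ)    a m           = not (value φ a m)
value (φ ∧ ψ)  a (m , m′)    = value φ a m Bool.∧ value ψ a m′
value (X φ)    a (b , _)     = b
value (φ U ψ)  a (b , m , m′) = value ψ a m′ Bool.∨ (value φ a m Bool.∧ b)

step : (φ : LTLf k) → Letter k → Memory φ → Memory φ
step (atom p) a m            = m
step (~ φ)    a m            = step φ a m
step (φ ∧ ψ)  a (m , m′)     = step φ a m , step ψ a m′
step (X φ)    a (_ , m)      = value φ a m , step φ a m
step (φ U ψ)  a x@(_ , m , m′) = value (φ U ψ) a x , step φ a m , step ψ a m′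

foldBack : (Σ → S → S) → Vec Σ n → S → S
foldBack f []      s = s
foldBack f (a ∷ w) s = f a (foldBack f w s)

memory : (φ : LTLf k) → Vec (Letter k) n → Memory φ
memory φ τ = foldBack (step φ) τ (end φ)

-- This and the next two lemmas hold because `step` updates the memories of the immediate
-- subformulas independently.
memory-∧ : ∀ (φ ψ : LTLf k) (τ : Vec (Letter k) n) →
           memory (φ ∧ ψ) τ ≡ (memory φ τ , memory ψ τ)
memory-∧ φ ψ []      = refl
memory-∧ φ ψ (a ∷ τ) = cong (step (φ ∧ ψ) a) (memory-∧ φ ψ τ)

memory-X : ∀ (φ : LTLf k) (τ : Vec (Letter k) n) →
           proj₂ (memory (X φ) τ) ≡ memory φ τ
memory-X φ []      = refl
memory-X φ (a ∷ τ) = cong (step φ a) (memory-X φ τ)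

memory-U : ∀ (φ ψ : LTLf k) (τ : Vec (Letter k) n) →
           proj₂ (memory (φ U ψ) τ) ≡ (memory φ τ , memory ψ τ)
memory-U φ ψ []      = refl
memory-U φ ψ (a ∷ τ) = cong (step (φ ∧ ψ) a) (memory-U φ ψ τ)

mutual
  -- Induction on the formula, with an inner induction on the trace for Until. Only `Next` and
  -- `Until` meet the empty trace, where `end` supplies the right bits.
  value-reflects : ∀ (φ : LTLf k) a (τ : Vec (Letter k) n) →
                   Reflects (a ∷ τ at zero ⊨ φ) (value φ a (memory φ τ))
  value-reflects (atom p) a τ = proof (p ∈? a)
  value-reflects (~ φ)    a τ = ¬-reflects (value-reflects φ a τ)
  value-reflects (φ ∧ ψ)  a τ rewrite memory-∧ φ ψ τ =
    value-reflects φ a τ ×-reflects value-reflects ψ a τ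
  value-reflects (X φ)    a τ = reflects-⇔ (Next-unfold φ a τ) (next-reflects φ τ)
  value-reflects (φ U ψ)  a τ = reflects-⇔ (Until⇔U φ ψ a τ) (until-reflects φ ψ (a ∷ τ))

  next-reflects : ∀ (φ : LTLf k) (τ : Vec (Letter k) n) →
                  Reflects (Next φ τ) (proj₁ (memory (X φ) τ))
  next-reflects φ []      = ofʸ λ ()
  next-reflects φ (a ∷ τ) rewrite memory-X φ τ =
    reflects-⇔ (mk⇔ (λ p _ → p) (λ f → f z<s)) (value-reflects φ a τ)

  until-reflects : ∀ (φ ψ : LTLf k) (τ : Vec (Letter k) n) →
                   Reflects (Until φ ψ τ) (proj₁ (memory (φ U ψ) τ))
  until-reflects φ ψ []      = ofⁿ λ ()
  until-reflects φ ψ (a ∷ τ) rewrite memory-U φ ψ τ =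
    reflects-⇔ (Until-unfold φ ψ a τ)
      (value-reflects ψ a τ ⊎-reflects (value-reflects φ a τ ×-reflects until-reflects φ ψ τ))

memorySize : LTLf k → ℕ
memorySize (atom p) = 1
memorySize (~ φ)    = memorySize φ
memorySize (φ ∧ ψ)  = memorySize φ * memorySize ψ
memorySize (X φ)    = 2 * memorySize φ
memorySize (φ U ψ)  = 2 * (memorySize φ * memorySize ψ)

Memory↔Fin : (φ : LTLf k) → Memory φ ↔ Fin (memorySize φ)
Memory↔Fin (atom p) = ↔-sym 1↔⊤
Memory↔Fin (~ φ)    = Memory↔Fin φ
Memory↔Fin (φ ∧ ψ)  = ↔-trans (Memory↔Fin φ ×-↔ Memory↔Fin ψ) (↔-sym *↔×)
Memory↔Fin (X φ)    = ↔-trans (↔-sym 2↔Bool ×-↔ Memory↔Fin φ) (↔-sym *↔×)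
Memory↔Fin (φ U ψ)  =
  ↔-trans (↔-sym 2↔Bool ×-↔ ↔-trans (Memory↔Fin φ ×-↔ Memory↔Fin ψ) (↔-sym *↔×)) (↔-sym *↔×)

-- Deterministic automata

record Automaton (Σ : Set) : Set where
  field
    T : TransitionSystem Σ
  open TransitionSystem T public
  field
    final : Q → Bool

open Automaton using (size; final; run)

-- The automaton of the reversed language: its states are the sets of those
-- s : S which lead into the target set.
module Reversal (S↔Fin : S ↔ Fin n) (stepBack : Σ → S → S)
                (start : S) (target : S → Bool) where
  open Inverse S↔Fin renaming (to to encode; from to decode; strictlyInverseʳ to decode-encode)

  member : Fin (2 ^ n) → S → Bool
  member q s = Inverse.to 2↔Bool (finToFun q (encode s))

  set : (S → Bool) → Fin (2 ^ n)
  set P = funToFin (Inverse.from 2↔Bool ∘ P ∘ decode)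

  member-set : ∀ P s → member (set P) s ≡ P s
  member-set P s = begin
    Inverse.to 2↔Bool (finToFun (set P) (encode s))
      ≡⟨ cong (Inverse.to 2↔Bool) (finToFun-funToFin _ (encode s)) ⟩
    Inverse.to 2↔Bool (Inverse.from 2↔Bool (P (decode (encode s))))
      ≡⟨ Inverse.strictlyInverseˡ 2↔Bool _ ⟩
    P (decode (encode s))
      ≡⟨ cong P (decode-encode s) ⟩
    P s ∎
    where open ≡-Reasoning

  reversal : Automaton Σ
  reversal = record
    { T = record
      { size = 2 ^ n
      ; ι    = set target
      -- The newest letter comes first in the backward traversal, hence the preimage under
      -- `stepBack a`.
      ; δ    = λ q a → set (member q ∘ stepBack a)
      }
    ; final = λ q → member q start
    }

  foldBack-prefix-suc : ∀ w i s →
    foldBack stepBack (prefix (suc i) w) s ≡ foldBack stepBack (prefix i w) (stepBack (w i) s)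
  foldBack-prefix-suc w zero    s = refl
  foldBack-prefix-suc w (suc i) s = cong (stepBack (w 0)) (foldBack-prefix-suc (w ∘ suc) i s)

  -- The claim is for all `s` because the induction step passes from `s` to `stepBack (w i) s`.
  member-run : ∀ w i s → member (run reversal w i) s ≡ target (foldBack stepBack (prefix i w) s)
  member-run w zero    s = member-set target s
  member-run w (suc i) s = begin
    member (set (member (run reversal w i) ∘ stepBack (w i))) s
      ≡⟨ member-set _ s ⟩
    member (run reversal w i) (stepBack (w i) s)
      ≡⟨ member-run w i _ ⟩
    target (foldBack stepBack (prefix i w) (stepBack (w i) s))
      ≡⟨ cong target (foldBack-prefix-suc w i s) ⟨
    target (foldBack stepBack (prefix (suc i) w) s) ∎
    where open ≡-Reasoning

-- The memory of X Φ rather than Φ, because its first bit holds the value of Φ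
-- at the leftmost position folded over.
LTLf-automaton : LTLf k → Automaton (Letter k)
LTLf-automaton Φ = Reversal.reversal (Memory↔Fin (X Φ)) (step (X Φ)) (end (X Φ)) proj₁

LTLf-automaton-reflects : ∀ (Φ : LTLf k) w m →
  let A = LTLf-automaton Φ in
  Reflects ([ Φ ] (prefix (suc m) w)) (final A (run A w (suc m)))
LTLf-automaton-reflects Φ w m
  rewrite Reversal.member-run (Memory↔Fin (X Φ)) (step (X Φ)) (end (X Φ)) proj₁
            w (suc m) (end (X Φ))
        | memory-X Φ (prefix m (w ∘ suc))
  = value-reflects Φ (w 0) (prefix m (w ∘ suc))

-- Weakness and eventual verdicts

-- A pairwise form of the SCC condition, which passes to products by projecting paths.
Weak : Automaton Σ → Set
Weak A = ∀ {p q} → Reachable p q → Reachable q p → final A p ≡ final A q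
  where open Automaton A using (Reachable)

-- Eventual constancy, unlike visiting final states infinitely often, is preserved by complements
-- and products.
Settles : (A : Automaton Σ) → InfTrace Σ → Set → Set
Settles A w P = Σ[ P? ∈ Dec P ] ∃[ N ] (∀ j → N ≤ j → final A (run A w j) ≡ does P?)

Settles-⇔ : ∀ {A : Automaton Σ} {w P P′} → P ⇔ P′ → Settles A w P → Settles A w P′
Settles-⇔ P⇔P′ (P? , settled) = Dec.map P⇔P′ P? , settled

module _ (A : Automaton Σ) where
  open Automaton A using (δ; ι)

  sinkδ : Fin (suc (size A)) → Σ → Fin (suc (size A))
  sinkδ zero    a = zero
  sinkδ (suc q) a = if final A (δ q a) then zero else suc (δ q a)

  isSink : Fin (suc (size A)) → Bool
  isSink zero    = true
  isSink (suc _) = false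

  -- Finality of the initial state is ignored, in accordance with ∃ᵖ ranging
  -- over nonempty prefixes.
  eventually : Automaton Σ
  eventually = record
    { T     = record { size = suc (size A) ; ι = suc ι ; δ = sinkδ }
    ; final = isSink
    }

  open Automaton eventually using () renaming (Reachable to Reachable⁺)

  sink-absorbing : ∀ {q} → Reachable⁺ zero q → q ≡ zero
  sink-absorbing ε              = refl
  sink-absorbing ((_ , refl) ◅ r) = sink-absorbing r

  -- The sink is the only final state and cannot be left, so no other state is mutually reachable
  -- with it.
  eventually-weak : Weak eventually
  eventually-weak {zero}  {q}     r _ rewrite sink-absorbing r = refl
  eventually-weak {suc p} {zero}  _ r with () ← sink-absorbing r
  eventually-weak {suc p} {suc q} _ _ = refl

  run-eventually : ∀ w i →
    run eventually w i ≡ zero ⊎ run eventually w i ≡ suc (run A w i)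
  run-eventually w zero = inj₂ refl
  run-eventually w (suc i) with run-eventually w i
  ... | inj₁ eq rewrite eq = inj₁ refl
  ... | inj₂ eq rewrite eq with final A (δ (run A w i) (w i))
  ...   | true  = inj₁ refl
  ...   | false = inj₂ refl

  run-eventually-hit : ∀ w i → final A (run A w (suc i)) ≡ true → run eventually w (suc i) ≡ zero
  run-eventually-hit w i hit with run-eventually w i
  ... | inj₁ eq rewrite eq = refl
  ... | inj₂ eq rewrite eq | hit = refl

  run-eventually-stays : ∀ w {i j} → i ℕ.≤′ j → run eventually w i ≡ zero → run eventually w j ≡ zero
  run-eventually-stays w ℕ.≤′-refl        eq = eq
  run-eventually-stays w (ℕ.≤′-step i≤j) eq rewrite run-eventually-stays w i≤j eq = refl

  run-eventually-miss : ∀ w → (∀ i → final A (run A w (suc i)) ≡ false) →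
    ∀ i → run eventually w i ≡ suc (run A w i)
  run-eventually-miss w miss zero = refl
  run-eventually-miss w miss (suc i)
    rewrite run-eventually-miss w miss i | miss i = refl

  eventually-settles : ∀ w {P : ℕ → Set} →
    (∀ m → Reflects (P m) (final A (run A w (suc m)))) →
    Dec (∃ P) → Settles eventually w (∃ P)
  eventually-settles w {P} r ∃P?@(yes (m , p)) =
    -- The witness `m` stands for a prefix of `suc m` letters, so the sink is certain from step
    -- `suc m` on.
    ∃P? , suc m , λ j m<j →
      cong isSink (run-eventually-stays w (≤⇒≤′ m<j)
        (run-eventually-hit w m (Reflects.det (r m) (ofʸ p))))
  eventually-settles w {P} r ∃P?@(no ¬∃P) =
    ∃P? , 0 , λ j _ →
      cong isSink (run-eventually-miss w (λ i → Reflects.det (r i) (ofⁿ λ p → ¬∃P (i , p))) j)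

-- Boolean combinations

complement : Automaton Σ → Automaton Σ
complement A = record { T = Automaton.T A ; final = not ∘ final A }

complement-weak : ∀ {A : Automaton Σ} → Weak A → Weak (complement A)
complement-weak A-weak p→q q→p = cong not (A-weak p→q q→p)

complement-settles : ∀ {A : Automaton Σ} {w P} → Settles A w P → Settles (complement A) w (¬ P)
complement-settles (P? , N , settled) = ¬? P? , N , λ j N≤j → cong not (settled j N≤j)

module Product (_∙_ : Bool → Bool → Bool) (A B : Automaton Σ) where
  private
    module A = Automaton A
    module B = Automaton B

  left : Fin (size A * size B) → A.Q
  left q = proj₁ (remQuot {size A} (size B) q)

  right : Fin (size A * size B) → B.Q
  right q = proj₂ (remQuot {size A} (size B) q)

  product : Automaton Σ
  product = record
    { T = record
      { size = A.size * B.size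
      ; ι    = combine A.ι B.ι
      ; δ    = λ q a → combine (A.δ (left q) a) (B.δ (right q) a)
      }
    ; final = λ q → A.final (left q) ∙ B.final (right q)
    }

  open Automaton product using (Reachable)

  left-combine : ∀ p q → left (combine {A.size} p q) ≡ p
  left-combine p q = cong proj₁ (remQuot-combine {A.size} p q)

  right-combine : ∀ p q → right (combine {A.size} p q) ≡ q
  right-combine p q = cong proj₂ (remQuot-combine {A.size} p q)

  left-reachable : ∀ {p q} → Reachable p q → A.Reachable (left p) (left q)
  left-reachable = gmap left λ { (a , refl) → a , sym (left-combine _ _) }

  right-reachable : ∀ {p q} → Reachable p q → B.Reachable (right p) (right q)
  right-reachable = gmap right λ { {p} (a , refl) → a , sym (right-combine (A.δ (left p) a) _) }

  product-weak : Weak A → Weak B → Weak product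
  product-weak A-weak B-weak p→q q→p = cong₂ _∙_
    (A-weak (left-reachable p→q) (left-reachable q→p))
    (B-weak (right-reachable p→q) (right-reachable q→p))

  left-run : ∀ w i → left (run product w i) ≡ run A w i
  left-run w zero    = left-combine _ _
  left-run w (suc i) = trans (left-combine _ _) (cong (λ q → A.δ q (w i)) (left-run w i))

  right-run : ∀ w i → right (run product w i) ≡ run B w i
  right-run w zero    = right-combine A.ι B.ι
  right-run w (suc i) = trans
    (right-combine (A.δ (left (run product w i)) (w i)) _)
    (cong (λ q → B.δ q (w i)) (right-run w i))

  -- Past the later of the two settling points both verdicts are fixed. Abstracting over `_⊙_`
  -- covers disjunction and conjunction at once.
  product-settles : ∀ {w P P′ R} (_⊙_ : Dec P → Dec P′ → Dec R) →
    (∀ p p′ → does (p ⊙ p′) ≡ does p ∙ does p′) →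
    Settles A w P → Settles B w P′ → Settles product w R
  product-settles {w} _⊙_ does-⊙ (P? , M , P-settled) (P′? , N , P′-settled) =
    P? ⊙ P′? , M ⊔ N , λ j M⊔N≤j → begin
      A.final (left (run product w j)) ∙ B.final (right (run product w j))
        ≡⟨ cong₂ (λ p q → A.final p ∙ B.final q) (left-run w j) (right-run w j) ⟩
      A.final (run A w j) ∙ B.final (run B w j)
        ≡⟨ cong₂ _∙_ (P-settled j (≤-trans (m≤m⊔n M N) M⊔N≤j))
                     (P′-settled j (≤-trans (m≤n⊔m M N) M⊔N≤j)) ⟩
      does P? ∙ does P′?
        ≡⟨ does-⊙ P? P′? ⟨
      does (P? ⊙ P′?) ∎
    where open ≡-Reasoning

open Product using (product; product-weak; product-settles)

-- From pairwise weakness to DWAs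

module _ (A : Automaton Σ) where
  open Automaton A using (IsSCC)

  finals : Subset (size A)
  finals = tabulate (final A)

  ∈-finals⁺ : ∀ {q} → final A q ≡ true → q ∈ finals
  ∈-finals⁺ {q} eq = lookup⇒[]= q finals (trans (lookup∘tabulate (final A) q) eq)

  ∈-finals⁻ : ∀ {q} → q ∈ finals → final A q ≡ true
  ∈-finals⁻ {q} q∈F = trans (sym (lookup∘tabulate (final A) q)) ([]=⇒lookup q∈F)

  toDWA : Weak A → DWA Σ
  toDWA A-weak = record
    { T    = Automaton.T A
    ; F    = finals
    ; weak = weak
    }
    where
    weak : ∀ S → IsSCC S → S ⊆ finals ⊎ Empty (S ∩ finals)
    weak S (mutually , _) with nonempty? (S ∩ finals)
    ... | no  disjoint = inj₂ disjoint
    ... | yes (p , p∈S∩F) with p∈S , p∈F ← x∈p∩q⁻ S finals p∈S∩F =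
      inj₁ λ q∈S → ∈-finals⁺
        (trans (A-weak (mutually q∈S p∈S) (mutually p∈S q∈S)) (∈-finals⁻ p∈F))

  -- The verdict is constant from `N` on, so a single visit to `F` past `N` determines acceptance.
  toDWA-accepts : ∀ (A-weak : Weak A) {w P} → Settles A w P → DWA.Accepts (toDWA A-weak) w ⇔ P
  toDWA-accepts A-weak {w} {P} (P? , N , settled) = mk⇔ accepted→P P→accepted
    where
    accepted→P : DWA.Accepts (toDWA A-weak) w → P
    accepted→P accepted with j , N≤j , j∈F ← accepted N =
      Reflects.invert (subst (Reflects P) (trans (sym (settled j N≤j)) (∈-finals⁻ j∈F)) (proof P?))

    P→accepted : P → DWA.Accepts (toDWA A-weak) w
    P→accepted p i =
      i ⊔ N , m≤m⊔n i N ,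
      ∈-finals⁺ (trans (settled (i ⊔ N) (m≤n⊔m i N)) (Reflects.det (proof P?) (ofʸ p)))

-- Obligation formulas

automaton : Obligation k → Automaton (Letter k)
-- Duality: every prefix satisfies `Φ` iff no prefix satisfies `~ Φ`.
automaton (∀ᵖ Φ)   = complement (eventually (LTLf-automaton (~ Φ)))
automaton (∃ᵖ Φ)   = eventually (LTLf-automaton Φ)
automaton (Ψ ∨ Ψ′) = product Bool._∨_ (automaton Ψ) (automaton Ψ′)
automaton (Ψ ∧ Ψ′) = product Bool._∧_ (automaton Ψ) (automaton Ψ′)
automaton (~ Ψ)    = complement (automaton Ψ)

automaton-weak : (Ψ : Obligation k) → Weak (automaton Ψ)
automaton-weak (∀ᵖ Φ)   =
  complement-weak {A = eventually (LTLf-automaton (~ Φ))} (eventually-weak _)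
automaton-weak (∃ᵖ Φ)   = eventually-weak _
automaton-weak (Ψ ∨ Ψ′) =
  product-weak Bool._∨_ (automaton Ψ) (automaton Ψ′) (automaton-weak Ψ) (automaton-weak Ψ′)
automaton-weak (Ψ ∧ Ψ′) =
  product-weak Bool._∧_ (automaton Ψ) (automaton Ψ′) (automaton-weak Ψ) (automaton-weak Ψ′)
automaton-weak (~ Ψ)    = complement-weak {A = automaton Ψ} (automaton-weak Ψ)

-- Excluded middle serves only to decide whether some prefix satisfies a given formula, an unbounded
-- search.
automaton-settles : ExcludedMiddle 0ℓ → ∀ (Ψ : Obligation k) τ → Settles (automaton Ψ) τ (τ ⊨ Ψ)
automaton-settles em (∀ᵖ Φ) τ =
  Settles-⇔ {A = automaton (∀ᵖ Φ)}
    -- Truth on a single finite prefix is decided by the automaton, which justifies removing the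
    -- double negation.
    (mk⇔ (λ ¬∃¬ m → decidable-stable (_ because LTLf-automaton-reflects Φ τ m) λ ¬p → ¬∃¬ (m , ¬p))
         (λ all (m , ¬p) → ¬p (all m)))
    (complement-settles {A = eventually (LTLf-automaton (~ Φ))}
      (eventually-settles _ τ (LTLf-automaton-reflects (~ Φ) τ) em))
automaton-settles em (∃ᵖ Φ) τ =
  eventually-settles _ τ (LTLf-automaton-reflects Φ τ) em
automaton-settles em (Ψ ∨ Ψ′) τ =
  product-settles _ (automaton Ψ) (automaton Ψ′) _⊎-dec_ (λ _ _ → refl)
    (automaton-settles em Ψ τ) (automaton-settles em Ψ′ τ)
automaton-settles em (Ψ ∧ Ψ′) τ =
  product-settles _ (automaton Ψ) (automaton Ψ′) _×-dec_ (λ _ _ → refl)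
    (automaton-settles em Ψ τ) (automaton-settles em Ψ′ τ)
automaton-settles em (~ Ψ) τ = complement-settles {A = automaton Ψ} (automaton-settles em Ψ τ)

-- Sizes

*-≤-2^ : ∀ {m n} a b → m ≤ 2 ^ a → n ≤ 2 ^ b → m * n ≤ 2 ^ (a + b)
*-≤-2^ {m} {n} a b m≤ n≤ = begin
  m * n           ≤⟨ *-mono-≤ m≤ n≤ ⟩
  2 ^ a * 2 ^ b   ≡⟨ ^-distribˡ-+-* 2 a b ⟨
  2 ^ (a + b)     ∎
  where open ≤-Reasoning

1+2^≤2^1+ : ∀ a → 1 + 2 ^ a ≤ 2 ^ (1 + a)
1+2^≤2^1+ a = begin
  1 + 2 ^ a       ≤⟨ +-monoˡ-≤ (2 ^ a) (m^n>0 2 a) ⟩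
  2 ^ a + 2 ^ a   ≡⟨ cong (2 ^ a +_) (+-identityʳ (2 ^ a)) ⟨
  2 ^ (1 + a)     ∎
  where open ≤-Reasoning

-- The factor 2 absorbs the extra bit of X Φ in LTLf-automaton.
2*memorySize≤ : (φ : LTLf k) → 2 * memorySize φ ≤ 2 ^ ∣ φ ∣ᶠ
2*memorySize≤ (atom p) = ≤-refl
2*memorySize≤ (~ φ)    = ≤-trans (2*memorySize≤ φ) (^-monoʳ-≤ 2 (n≤1+n ∣ φ ∣ᶠ))
2*memorySize≤ (φ ∧ ψ)  = *-monoʳ-≤ 2 (*-≤-2^ ∣ φ ∣ᶠ ∣ ψ ∣ᶠ (memorySize≤ φ) (memorySize≤ ψ))
  where
  memorySize≤ : (φ : LTLf k) → memorySize φ ≤ 2 ^ ∣ φ ∣ᶠ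
  memorySize≤ φ = ≤-trans (m≤m+n _ _) (2*memorySize≤ φ)
2*memorySize≤ (X φ)    = *-monoʳ-≤ 2 (2*memorySize≤ φ)
2*memorySize≤ (φ U ψ)  = *-monoʳ-≤ 2 (begin
  -- The symbol `U` has paid for one factor 2; the other goes to the bound for `φ`, and the slack in
  -- the bound for `ψ` is given up.
  2 * (memorySize φ * memorySize ψ)  ≡⟨ *-assoc 2 (memorySize φ) (memorySize ψ) ⟨
  2 * memorySize φ * memorySize ψ
    ≤⟨ *-≤-2^ ∣ φ ∣ᶠ ∣ ψ ∣ᶠ (2*memorySize≤ φ) (≤-trans (m≤m+n _ _) (2*memorySize≤ ψ)) ⟩
  2 ^ (∣ φ ∣ᶠ + ∣ ψ ∣ᶠ)              ∎)
  where open ≤-Reasoning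

-- The added sink costs one unit in the inner exponent, paid for by the symbol `∃ᵖ` or `∀ᵖ`.
eventually-size : (Φ : LTLf k) → size (eventually (LTLf-automaton Φ)) ≤ 2 ^ (2 ^ (1 + ∣ Φ ∣ᶠ))
eventually-size Φ = begin
  1 + 2 ^ (2 * memorySize Φ)  ≤⟨ s≤s (^-monoʳ-≤ 2 (2*memorySize≤ Φ)) ⟩
  1 + 2 ^ (2 ^ ∣ Φ ∣ᶠ)        ≤⟨ 1+2^≤2^1+ (2 ^ ∣ Φ ∣ᶠ) ⟩
  2 ^ (1 + 2 ^ ∣ Φ ∣ᶠ)        ≤⟨ ^-monoʳ-≤ 2 (1+2^≤2^1+ ∣ Φ ∣ᶠ) ⟩
  2 ^ (2 ^ (1 + ∣ Φ ∣ᶠ))      ∎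
  where open ≤-Reasoning

-- Both inner powers are at most `2 ^ (a + b)`; the symbol of the connective absorbs the doubling.
product-size : ∀ {m n} a b → m ≤ 2 ^ (2 ^ a) → n ≤ 2 ^ (2 ^ b) → m * n ≤ 2 ^ (2 ^ (1 + (a + b)))
product-size {m} {n} a b m≤ n≤ = begin
  m * n                             ≤⟨ *-≤-2^ (2 ^ a) (2 ^ b) m≤ n≤ ⟩
  2 ^ (2 ^ a + 2 ^ b)
    ≤⟨ ^-monoʳ-≤ 2 (+-mono-≤ (^-monoʳ-≤ 2 (m≤m+n a b)) (^-monoʳ-≤ 2 (m≤n+m b a))) ⟩
  2 ^ (2 ^ (a + b) + 2 ^ (a + b))   ≡⟨ cong (λ x → 2 ^ (2 ^ (a + b) + x)) (+-identityʳ _) ⟨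
  2 ^ (2 ^ (1 + (a + b)))           ∎
  where open ≤-Reasoning

automaton-size : (Ψ : Obligation k) → size (automaton Ψ) ≤ 2 ^ (2 ^ ∣ Ψ ∣)
-- The automaton is built from `~ Φ`, but negation leaves `memorySize` unchanged and complementation
-- keeps the states.
automaton-size (∀ᵖ Φ)   = eventually-size Φ
automaton-size (∃ᵖ Φ)   = eventually-size Φ
automaton-size (Ψ ∨ Ψ′) = product-size ∣ Ψ ∣ ∣ Ψ′ ∣ (automaton-size Ψ) (automaton-size Ψ′)
automaton-size (Ψ ∧ Ψ′) = product-size ∣ Ψ ∣ ∣ Ψ′ ∣ (automaton-size Ψ) (automaton-size Ψ′)
automaton-size (~ Ψ)    = ≤-trans (automaton-size Ψ) (^-monoʳ-≤ 2 (^-monoʳ-≤ 2 (n≤1+n ∣ Ψ ∣)))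

corollary2 : ∃[ c ] ((k : ℕ) (Ψ : Obligation k) →
    Σ[ A ∈ DWA (Letter k) ]
    (DWA.size A ≤ 2 ^ (2 ^ (c * ∣ Ψ ∣)) ×
    (ExcludedMiddle 0ℓ → (τ : InfTrace (Letter k)) → DWA.Accepts A τ ⇔ (τ ⊨ Ψ))))
-- Each symbol pays for its own growth, so the constant is 1.
corollary2 = 1 , λ k Ψ →
  toDWA (automaton Ψ) (automaton-weak Ψ) ,
  subst (λ x → size (automaton Ψ) ≤ 2 ^ (2 ^ x)) (sym (*-identityˡ ∣ Ψ ∣)) (automaton-size Ψ) ,
  λ em τ → toDWA-accepts (automaton Ψ) (automaton-weak Ψ) (automaton-settles em Ψ τ)
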